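{- For every integer $t \ge 2$, as $k\to\infty$, \[\operatorname{ex}^{ -1}(k,P_{2t}) \geq e\left(T\left(\left\lfloor\frac{k-1}{t-1}\right\rfloor,t\right)\right) = \frac{(k-1)^2}{2t(t-1)} + O(k).\]
   Context: For graphs $G$ and $F$, $\operatorname{ex}(G,F)$ denotes the maximum number of edges in a subgraph of $G$ containing no copy of $F$ as a subgraph. The inverse Turán number is $\operatorname{ex}^{ -1}(k,F)=\sup\{e(G): G \text{ is a graph with } \operatorname{ex}(G,F)<k\}$, i.e. the maximum number of edges in a graph $G$ every $k$-edge subgraph of which contains a copy of $F$. $P_{m}$ denotes the path with $m$ edges. $T(n,r)$ denotes the Turán graph: the complete $r$-partite graph on $n$ vertices with all parts of size $\lfloor n/r\rfloor$ or $\lceil n/r\rceil$; $e(\cdot)$ denotes the number of edges. Asymptotic notation is as $k\to\infty$ with $t$ fixed. -}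

module Defs where

open import Data.Nat using (ℕ; zero; suc; _+_; _*_; _∸_; _≤_; _<_; _<ᵇ_; NonZero; s≤s; z≤n)
open import Data.Nat.DivMod using (_%_; _/_)
open import Data.Nat.Properties using (_≟_)
open import Data.Bool using (Bool; true; false; not; _∧_; if_then_else_)
open import Data.Fin using (Fin; toℕ; inject₁) renaming (suc to fsuc)
open import Data.List using (List; map; allFin)
open import Data.Nat.ListAction using (sum)
open import Data.Product using (Σ; _×_; _,_)
open import Function.Definitions using (Injective)
open import Relation.Nullary using (yes; no; ¬_)
open import Relation.Nullary.Decidable using (⌊_⌋)
open import Relation.Binary.PropositionalEquality using (_≡_; refl; sym)

record Graph (n : ℕ) : Set where
  field
    adj    : Fin n → Fin n → Bool
    adj-sym    : ∀ i j → adj i j ≡ adj j i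
    adj-irrefl : ∀ i → adj i i ≡ false
open Graph public

edges : {n : ℕ} → Graph n → ℕ
edges {n} G =
  sum (map (λ i → sum (map (λ j → if (toℕ i <ᵇ toℕ j) ∧ adj G i j then 1 else 0)
                           (allFin n)))
           (allFin n))

-- H is a subgraph of G (same vertex set; dropping vertices only removes
-- isolated vertices, which does not affect edge counts or path copies)
_⊆G_ : {n : ℕ} → Graph n → Graph n → Set
_⊆G_ {n} H G = ∀ (i j : Fin n) → adj H i j ≡ true → adj G i j ≡ true

-- H contains a copy of the path P_m (m edges, m+1 distinct vertices)
ContainsPath : (m : ℕ) → {n : ℕ} → Graph n → Set
ContainsPath m {n} H =
  Σ (Fin (suc m) → Fin n) λ f →
    Injective _≡_ _≡_ f × (∀ (i : Fin m) → adj H (f (inject₁ i)) (f (fsuc i)) ≡ true)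

ExPathLt : {n : ℕ} → Graph n → (m k : ℕ) → Set
ExPathLt G m k = ∀ H → H ⊆G G → ¬ ContainsPath m H → edges H < k

-- ex^{-1}(k, P_m) ≥ N : the supremum of e(G) over graphs with ex(G,P_m) < k is ≥ N.
-- Since edge counts are natural numbers, this holds iff some such G has e(G) ≥ N.
InvExPathGe : (k m N : ℕ) → Set
InvExPathGe k m N = Σ ℕ λ n → Σ (Graph n) λ G → ExPathLt G m k × (N ≤ edges G)

-- Turán graph T(n,r): vertex i lies in part (i mod r); parts have sizes ⌊n/r⌋ or ⌈n/r⌉;
-- two vertices are adjacent iff they lie in different parts.
private
  diff : ℕ → ℕ → Bool
  diff a b = not ⌊ a ≟ b ⌋

  diff-sym : ∀ a b → diff a b ≡ diff b a
  diff-sym a b with a ≟ b | b ≟ a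
  ... | yes _ | yes _ = refl
  ... | no _  | no _  = refl
  ... | yes p | no q  with q (sym p)
  ... | ()
  diff-sym a b | no q | yes p with q (sym p)
  ... | ()

  diff-refl : ∀ a → diff a a ≡ false
  diff-refl a with a ≟ a
  ... | yes _ = refl
  ... | no q with q refl
  ... | ()

turan : (n r : ℕ) → .{{NonZero r}} → Graph n
turan n r = record
  { adj = λ i j → diff (toℕ i % r) (toℕ j % r)
  ; adj-sym = λ i j → diff-sym (toℕ i % r) (toℕ j % r)
  ; adj-irrefl = λ i → diff-refl (toℕ i % r)
  }

nz-t : {t : ℕ} → 2 ≤ t → NonZero t
nz-t (s≤s (s≤s _)) = _

nz-t-1 : {t : ℕ} → 2 ≤ t → NonZero (t ∸ 1)
nz-t-1 (s≤s (s≤s _)) = _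

turanEdges : (k t : ℕ) → 2 ≤ t → ℕ
turanEdges k t h =
  edges (turan (_/_ (k ∸ 1) (t ∸ 1) {{nz-t-1 h}}) t {{nz-t h}})

-- The Turán graph T(⌊(k − 1)/(t − 1)⌋, t) is the witness. A P_{2t}-free subgraph H of it is
-- properly t-coloured by the parts, and such an H has at most (t − 1)|V(H)| edges: delete
-- either a vertex of degree at most t − 1, or, when every degree is at least t, the vertex set
-- of a cycle built from a path that can no longer be extended, using Pósa's crossing at the
-- two ends. That cycle has at most 2t vertices and no edge leaves it, and at most 2t vertices
-- in t colour classes span at most (t − 1) times their number of bichromatic pairs. Counting
-- the edges of T(n, t) residue by residue gives 2t(t − 1) e(T(n, t)) = (t − 1)² n² + O(n).
module Submission where

open import Defs
open import Data.Bool using (Bool; true; false; not; _∧_; _∨_; if_then_else_)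
import Data.Bool.Properties as Boolₚ
open import Data.Empty using (⊥-elim)
open import Data.Fin using (Fin; toℕ; inject₁) renaming (zero to fzero; suc to fsuc)
import Data.Fin.Properties as Finₚ
open import Data.List using (List; []; _∷_; map; _++_; length; reverse; reverseAcc; allFin; tabulate)
open import Data.List.Properties using (map-∘; length-map; ++-identityʳ; length-++; length-tabulate; map-tabulate; map-cong)
open import Data.List.Membership.Propositional using (_∈_; _∉_)
open import Data.List.Membership.Propositional.Properties using (∈-allFin; ∈-∃++; ∈-++⁺ʳ)
open import Data.List.Relation.Binary.Permutation.Propositional using (_↭_; ↭-sym; ↭-trans; ↭⇒↭ₛ; prep)
open import Data.List.Relation.Binary.Permutation.Propositional.Properties using (++-comm; ++⁺ˡ; ↭-reverse; ↭-length; All-resp-↭; Any-resp-↭)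
import Data.List.Relation.Binary.Permutation.Setoid.Properties as ↭ₛ
open import Data.List.Relation.Unary.All using (All; []; _∷_)
import Data.List.Relation.Unary.All as All
import Data.List.Relation.Unary.All.Properties as Allₚ
open import Data.List.Relation.Unary.Any using (Any; here; there; satisfied; any?)
open import Data.List.Relation.Unary.AllPairs using ([]; _∷_)
open import Data.List.Relation.Unary.Unique.Propositional using (Unique)
open import Data.List.Relation.Unary.Unique.Propositional.Properties using (allFin⁺)
open import Data.Nat
open import Data.Nat.DivMod
open import Data.Nat.Divisibility using (n∣m*n)
open import Data.Nat.ListAction using (sum)
open import Data.Nat.Properties
open import Data.Nat.Tactic.RingSolver using (solve-∀)
open import Algebra.Properties.CommutativeSemigroup +-commutativeSemigroup using () renaming (interchange to +-interchange)
open import Data.Product using (Σ; _×_; _,_; proj₁; proj₂)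
open import Data.Sum using (_⊎_; inj₁; inj₂)
open import Data.Unit using (⊤; tt)
open import Function using (_∘_; id)
open import Function.Definitions using (Injective)
open import Relation.Binary.PropositionalEquality
open import Relation.Nullary using (Dec; yes; no; ¬_; ¬?)
open import Relation.Nullary.Decidable using (⌊_⌋; _×-dec_)

𝟙 : Bool → ℕ
𝟙 b = if b then 1 else 0

𝟙≤1 : ∀ b → 𝟙 b ≤ 1
𝟙≤1 true  = ≤-refl
𝟙≤1 false = z≤n

𝟙-not+𝟙 : ∀ b → 𝟙 (not b) + 𝟙 b ≡ 1
𝟙-not+𝟙 true  = refl
𝟙-not+𝟙 false = refl

∑ : {A : Set} → (A → ℕ) → List A → ℕ
∑ f xs = sum (map f xs)

module _ {A : Set} where

  ∑-cong : ∀ {f g : A → ℕ} xs → (∀ x → f x ≡ g x) → ∑ f xs ≡ ∑ g xs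
  ∑-cong []       p = refl
  ∑-cong (x ∷ xs) p = cong₂ _+_ (p x) (∑-cong xs p)

  ∑-mono : ∀ {f g : A → ℕ} xs → (∀ x → f x ≤ g x) → ∑ f xs ≤ ∑ g xs
  ∑-mono []       p = z≤n
  ∑-mono (x ∷ xs) p = +-mono-≤ (p x) (∑-mono xs p)

  ∑-+ : ∀ (f g : A → ℕ) xs → ∑ (λ x → f x + g x) xs ≡ ∑ f xs + ∑ g xs
  ∑-+ f g []       = refl
  ∑-+ f g (x ∷ xs) rewrite ∑-+ f g xs = +-interchange (f x) (g x) (∑ f xs) (∑ g xs)

  ∑-++ : ∀ (f : A → ℕ) xs ys → ∑ f (xs ++ ys) ≡ ∑ f xs + ∑ f ys
  ∑-++ f []       ys = refl
  ∑-++ f (x ∷ xs) ys rewrite ∑-++ f xs ys = sym (+-assoc (f x) _ _)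

  ∑-map : ∀ {C : Set} (f : C → ℕ) (g : A → C) xs → ∑ f (map g xs) ≡ ∑ (f ∘ g) xs
  ∑-map f g []       = refl
  ∑-map f g (x ∷ xs) = cong (f (g x) +_) (∑-map f g xs)

  ∑-0 : ∀ xs → ∑ (λ (_ : A) → 0) xs ≡ 0
  ∑-0 []       = refl
  ∑-0 (x ∷ xs) = ∑-0 xs

  ∑-1 : ∀ xs → ∑ (λ (_ : A) → 1) xs ≡ length xs
  ∑-1 []       = refl
  ∑-1 (x ∷ xs) = cong suc (∑-1 xs)

  ∑-if : ∀ b (f : A → ℕ) xs → ∑ (λ x → if b then f x else 0) xs ≡ (if b then ∑ f xs else 0)
  ∑-if true  f xs = refl
  ∑-if false f xs = ∑-0 xs

  ∑-member : ∀ (f : A → ℕ) {x} xs → x ∈ xs → f x ≤ ∑ f xs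
  ∑-member f (y ∷ ys) (here refl) = m≤m+n (f y) _
  ∑-member f (y ∷ ys) (there x∈) = ≤-trans (∑-member f ys x∈) (m≤n+m _ (f y))

  ∑𝟙+∑𝟙>length⇒both : ∀ (p q : A → Bool) xs → length xs < ∑ (𝟙 ∘ p) xs + ∑ (𝟙 ∘ q) xs →
                      Any (λ x → p x ≡ true × q x ≡ true) xs
  ∑𝟙+∑𝟙>length⇒both p q [] ()
  ∑𝟙+∑𝟙>length⇒both p q (x ∷ xs) lt with p x in px | q x in qx
  ... | true  | true  = here (px , qx)
  ... | true  | false = there (∑𝟙+∑𝟙>length⇒both p q xs (≤-pred lt))
  ... | false | true  = there (∑𝟙+∑𝟙>length⇒both p q xs (≤-pred (≤-trans lt (≤-reflexive (+-suc _ _)))))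
  ... | false | false = there (∑𝟙+∑𝟙>length⇒both p q xs (≤-trans (n≤1+n _) lt))

  Unique-resp-↭ : ∀ {xs ys : List A} → xs ↭ ys → Unique xs → Unique ys
  Unique-resp-↭ p = ↭ₛ.Unique-resp-↭ (setoid A) (↭⇒↭ₛ p)

∑< : ℕ → (ℕ → ℕ) → ℕ
∑< zero    f = 0
∑< (suc n) f = ∑< n f + f n

∑<-cong : ∀ n {f g : ℕ → ℕ} → (∀ a → a < n → f a ≡ g a) → ∑< n f ≡ ∑< n g
∑<-cong zero    p = refl
∑<-cong (suc n) p = cong₂ _+_ (∑<-cong n (λ a a<n → p a (m<n⇒m<1+n a<n))) (p n ≤-refl)

∑<-mono : ∀ n {f g : ℕ → ℕ} → (∀ a → a < n → f a ≤ g a) → ∑< n f ≤ ∑< n g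
∑<-mono zero    p = z≤n
∑<-mono (suc n) p = +-mono-≤ (∑<-mono n (λ a a<n → p a (m<n⇒m<1+n a<n))) (p n ≤-refl)

∑<-+ : ∀ n (f g : ℕ → ℕ) → ∑< n (λ a → f a + g a) ≡ ∑< n f + ∑< n g
∑<-+ zero    f g = refl
∑<-+ (suc n) f g rewrite ∑<-+ n f g = +-interchange (∑< n f) (∑< n g) (f n) (g n)

∑<-* : ∀ n c (f : ℕ → ℕ) → ∑< n (λ a → c * f a) ≡ c * ∑< n f
∑<-* zero    c f = sym (*-zeroʳ c)
∑<-* (suc n) c f rewrite ∑<-* n c f = sym (*-distribˡ-+ c (∑< n f) (f n))

∑<-1 : ∀ n → ∑< n (λ _ → 1) ≡ n
∑<-1 zero    = refl
∑<-1 (suc n) rewrite ∑<-1 n = +-comm n 1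

∑<-member : ∀ n (f : ℕ → ℕ) {a} → a < n → f a ≤ ∑< n f
∑<-member (suc n) f {a} a<1+n with a ≟ n
... | yes refl = m≤n+m (f a) (∑< n f)
... | no a≢n   = ≤-trans (∑<-member n f (≤∧≢⇒< (≤-pred a<1+n) a≢n)) (m≤m+n _ _)

∑<-suc : ∀ n f → ∑< (suc n) f ≡ f 0 + ∑< n (f ∘ suc)
∑<-suc zero    f = +-comm 0 (f 0)
∑<-suc (suc n) f rewrite ∑<-suc n f = +-assoc (f 0) (∑< n (f ∘ suc)) (f (suc n))

∑-allFin : ∀ n (f : ℕ → ℕ) → ∑ (f ∘ toℕ) (allFin n) ≡ ∑< n f
∑-allFin n f = trans (cong sum (map-tabulate {n = n} id (f ∘ toℕ))) (∑-tabulate n f)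
  where
  ∑-tabulate : ∀ n (f : ℕ → ℕ) → sum (tabulate {n = n} (f ∘ toℕ)) ≡ ∑< n f
  ∑-tabulate zero    f = refl
  ∑-tabulate (suc n) f = trans (cong (f 0 +_) (∑-tabulate n (f ∘ suc))) (sym (∑<-suc n f))

⌊≟⌋-refl : ∀ r → ⌊ r ≟ r ⌋ ≡ true
⌊≟⌋-refl r with r ≟ r
... | yes _   = refl
... | no r≢r  = ⊥-elim (r≢r refl)

⌊≟⌋-false : ∀ {a b} → a ≢ b → ⌊ a ≟ b ⌋ ≡ false
⌊≟⌋-false {a} {b} a≢b with a ≟ b
... | yes a≡b = ⊥-elim (a≢b a≡b)
... | no _    = refl

⌊≟⌋-sym : ∀ a b → ⌊ a ≟ b ⌋ ≡ ⌊ b ≟ a ⌋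
⌊≟⌋-sym a b with a ≟ b | b ≟ a
... | yes _   | yes _   = refl
... | no _    | no _    = refl
... | yes a≡b | no b≢a  = ⊥-elim (b≢a (sym a≡b))
... | no a≢b  | yes b≡a = ⊥-elim (a≢b (sym b≡a))

<ᵇ-irrefl : ∀ a → (a <ᵇ a) ≡ false
<ᵇ-irrefl zero    = refl
<ᵇ-irrefl (suc a) = <ᵇ-irrefl a

<ᵇ-asym : ∀ a b → (a <ᵇ b) ≡ true → (b <ᵇ a) ≡ false
<ᵇ-asym zero    (suc b) _   = refl
<ᵇ-asym (suc a) (suc b) a<b = <ᵇ-asym a b a<b

<ᵇ-true : ∀ {a b} → a < b → (a <ᵇ b) ≡ true
<ᵇ-true {zero}  {suc b} _         = refl
<ᵇ-true {suc a} {suc b} (s≤s a<b) = <ᵇ-true a<b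

<ᵇ-false : ∀ {a b} → b ≤ a → (a <ᵇ b) ≡ false
<ᵇ-false {a}     {zero}  _         = refl
<ᵇ-false {suc a} {suc b} (s≤s b≤a) = <ᵇ-false b≤a

⌊suc≟suc⌋ : ∀ a b → ⌊ suc a ≟ suc b ⌋ ≡ ⌊ a ≟ b ⌋
⌊suc≟suc⌋ a b with a ≟ b
... | yes refl = ⌊≟⌋-refl (suc a)
... | no a≢b   = ⌊≟⌋-false (a≢b ∘ suc-injective)

𝟙<ᵇ+𝟙≟ : ∀ r ρ → 𝟙 (r <ᵇ ρ) + 𝟙 ⌊ ρ ≟ r ⌋ ≡ 𝟙 (r <ᵇ suc ρ)
𝟙<ᵇ+𝟙≟ zero    zero    = refl
𝟙<ᵇ+𝟙≟ zero    (suc ρ) = refl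
𝟙<ᵇ+𝟙≟ (suc r) zero    = refl
𝟙<ᵇ+𝟙≟ (suc r) (suc ρ) rewrite ⌊suc≟suc⌋ ρ r = 𝟙<ᵇ+𝟙≟ r ρ

ascending+descending≤ : ∀ a b {r r′} → r′ ≡ r → 𝟙 ((a <ᵇ b) ∧ r) + 𝟙 ((b <ᵇ a) ∧ r′) ≤ 𝟙 r
ascending+descending≤ a b refl with a <ᵇ b in a<b | b <ᵇ a in b<a
... | false | false = z≤n
... | true  | false = ≤-reflexive (+-identityʳ _)
... | false | true  = ≤-refl
... | true  | true  with trans (sym (<ᵇ-asym a b a<b)) b<a
... | ()

⌊⌋≡true⇒ : ∀ {P : Set} (P? : Dec P) → ⌊ P? ⌋ ≡ true → P
⌊⌋≡true⇒ (yes p) _ = p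

not⌊⌋≡true⇒ : ∀ {P : Set} (P? : Dec P) → not ⌊ P? ⌋ ≡ true → ¬ P
not⌊⌋≡true⇒ (no ¬p) _ = ¬p

∧-true⁻ : ∀ {a b} → (a ∧ b) ≡ true → a ≡ true × b ≡ true
∧-true⁻ {true} b≡true = refl , b≡true

-- Colour classes

countEq countNeq : ℕ → List ℕ → ℕ
countEq  r = ∑ (λ s → 𝟙 ⌊ r ≟ s ⌋)
countNeq r = ∑ (λ s → 𝟙 (not ⌊ r ≟ s ⌋))

bichromaticPairs monochromaticPairs : List ℕ → ℕ
bichromaticPairs []      = 0
bichromaticPairs (r ∷ R) = bichromaticPairs R + countNeq r R
monochromaticPairs []      = 0
monochromaticPairs (r ∷ R) = monochromaticPairs R + countEq r R

choose2 : ℕ → ℕ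
choose2 zero    = 0
choose2 (suc c) = choose2 c + c

2*choose2 : ∀ c → 2 * choose2 (suc c) ≡ suc c * c
2*choose2 zero    = refl
2*choose2 (suc c) = trans (*-distribˡ-+ 2 (choose2 (suc c)) (suc c)) (trans (cong (_+ 2 * suc c) (2*choose2 c)) (square c))
  where
  square : ∀ c → suc c * c + 2 * suc c ≡ suc (suc c) * suc c
  square = solve-∀

bichromatic+monochromatic : ∀ R → bichromaticPairs R + monochromaticPairs R ≡ choose2 (length R)
bichromatic+monochromatic []      = refl
bichromatic+monochromatic (r ∷ R) = begin
  bichromaticPairs R + countNeq r R + (monochromaticPairs R + countEq r R)
    ≡⟨ +-interchange (bichromaticPairs R) (countNeq r R) (monochromaticPairs R) (countEq r R) ⟩
  bichromaticPairs R + monochromaticPairs R + (countNeq r R + countEq r R)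
    ≡⟨ cong₂ _+_ (bichromatic+monochromatic R) (sym (∑-+ _ _ R)) ⟩
  choose2 (length R) + ∑ (λ s → 𝟙 (not ⌊ r ≟ s ⌋) + 𝟙 ⌊ r ≟ s ⌋) R
    ≡⟨ cong (choose2 (length R) +_) (trans (∑-cong R (λ s → 𝟙-not+𝟙 ⌊ r ≟ s ⌋)) (∑-1 R)) ⟩
  choose2 (length R) + length R ∎
  where
  open ≡-Reasoning

memberᵇ : ℕ → List ℕ → Bool
memberᵇ ρ []      = false
memberᵇ ρ (s ∷ R) = ⌊ ρ ≟ s ⌋ ∨ memberᵇ ρ R

memberᵇ⇒1≤countEq : ∀ r R → memberᵇ r R ≡ true → 1 ≤ countEq r R
memberᵇ⇒1≤countEq r (s ∷ R) r∈R with r ≟ s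
... | yes _ = s≤s z≤n
... | no _  = ≤-trans (memberᵇ⇒1≤countEq r R r∈R) (m≤n+m _ _)

colourCount : ℕ → List ℕ → ℕ
colourCount t R = ∑< t (λ ρ → 𝟙 (memberᵇ ρ R))

colourCount≤ : ∀ t R → colourCount t R ≤ t
colourCount≤ t R = ≤-trans (∑<-mono t (λ ρ _ → 𝟙≤1 (memberᵇ ρ R))) (≤-reflexive (∑<-1 t))

colourCount-mono-∷ : ∀ t r R → colourCount t R ≤ colourCount t (r ∷ R)
colourCount-mono-∷ t r R = ∑<-mono t pointwise
  where
  pointwise : ∀ ρ → ρ < t → 𝟙 (memberᵇ ρ R) ≤ 𝟙 (⌊ ρ ≟ r ⌋ ∨ memberᵇ ρ R)
  pointwise ρ _ with ρ ≟ r
  ... | yes _ = 𝟙≤1 _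
  ... | no _  = ≤-refl

colourCount-new : ∀ t r R → r < t → memberᵇ r R ≡ false → colourCount t R + 1 ≤ colourCount t (r ∷ R)
colourCount-new t r R r<t r∉R = begin
  colourCount t R + 1                                 ≤⟨ +-monoʳ-≤ (colourCount t R) r-counted ⟩
  colourCount t R + ∑< t (λ ρ → 𝟙 ⌊ ρ ≟ r ⌋)          ≡⟨ sym (∑<-+ t _ _) ⟩
  ∑< t (λ ρ → 𝟙 (memberᵇ ρ R) + 𝟙 ⌊ ρ ≟ r ⌋)          ≤⟨ ∑<-mono t pointwise ⟩
  colourCount t (r ∷ R)                               ∎
  where
  open ≤-Reasoning
  r-counted : 1 ≤ ∑< t (λ ρ → 𝟙 ⌊ ρ ≟ r ⌋)
  r-counted = ≤-trans (≤-reflexive (cong 𝟙 (sym (⌊≟⌋-refl r)))) (∑<-member t (λ ρ → 𝟙 ⌊ ρ ≟ r ⌋) r<t)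
  pointwise : ∀ ρ → ρ < t → 𝟙 (memberᵇ ρ R) + 𝟙 ⌊ ρ ≟ r ⌋ ≤ 𝟙 (⌊ ρ ≟ r ⌋ ∨ memberᵇ ρ R)
  pointwise ρ _ with ρ ≟ r
  ... | yes refl rewrite r∉R = ≤-refl
  ... | no _     = ≤-reflexive (+-identityʳ _)

-- Each entry of R either repeats a later colour or is the last occurrence of its colour.
length≤monochromatic+colourCount : ∀ t R → All (_< t) R → length R ≤ monochromaticPairs R + colourCount t R
length≤monochromatic+colourCount t []      _          = z≤n
length≤monochromatic+colourCount t (r ∷ R) (r<t ∷ R<t) with memberᵇ r R in r∈?R
... | true  = begin
  suc (length R)                                   ≤⟨ s≤s (length≤monochromatic+colourCount t R R<t) ⟩
  suc (monochromaticPairs R + colourCount t R)     ≡⟨ cong (_+ colourCount t R) (+-comm 1 (monochromaticPairs R)) ⟩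
  monochromaticPairs R + 1 + colourCount t R       ≤⟨ +-mono-≤ (+-monoʳ-≤ (monochromaticPairs R) (memberᵇ⇒1≤countEq r R r∈?R))
                                                               (colourCount-mono-∷ t r R) ⟩
  monochromaticPairs (r ∷ R) + colourCount t (r ∷ R) ∎
  where open ≤-Reasoning
... | false = begin
  suc (length R)                                   ≤⟨ s≤s (length≤monochromatic+colourCount t R R<t) ⟩
  suc (monochromaticPairs R + colourCount t R)     ≡⟨ sym (trans (cong (monochromaticPairs R +_) (+-comm (colourCount t R) 1)) (+-suc _ _)) ⟩
  monochromaticPairs R + (colourCount t R + 1)     ≤⟨ +-mono-≤ (m≤m+n (monochromaticPairs R) (countEq r R))
                                                               (colourCount-new t r R r<t r∈?R) ⟩
  monochromaticPairs (r ∷ R) + colourCount t (r ∷ R) ∎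
  where open ≤-Reasoning

-- c entries with at most t colours span at least c − t monochromatic pairs, so at most
-- choose2 c − c + t bichromatic ones, and this is at most (t − 1) c exactly when c ≤ 2t.
bichromaticPairs≤ : ∀ u R → All (_< suc u) R → length R ≤ 2 * suc u → bichromaticPairs R ≤ u * length R
bichromaticPairs≤ u []          _   _   = z≤n
bichromaticPairs≤ u R@(_ ∷ R′)  R<t c≤2t = +-cancelˡ-≤ c _ _ (begin
  c + bichromaticPairs R        ≡⟨ +-comm c _ ⟩
  bichromaticPairs R + c        ≤⟨ +-monoʳ-≤ (bichromaticPairs R) (≤-trans (length≤monochromatic+colourCount t R R<t)
                                                                  (+-monoʳ-≤ _ (colourCount≤ t R))) ⟩
  bichromaticPairs R + (monochromaticPairs R + t)   ≡⟨ sym (+-assoc (bichromaticPairs R) _ _) ⟩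
  bichromaticPairs R + monochromaticPairs R + t     ≡⟨ cong (_+ t) (bichromatic+monochromatic R) ⟩
  choose2 c + t                 ≤⟨ choose2+t≤t*c ⟩
  t * c                         ≡⟨⟩
  c + u * c                     ∎)
  where
  open ≤-Reasoning
  t c : ℕ
  t = suc u
  c = length R
  choose2+t≤t*c : choose2 c + t ≤ t * c
  choose2+t≤t*c = *-cancelˡ-≤ 2 (begin
    2 * (choose2 c + t)                ≡⟨ *-distribˡ-+ 2 (choose2 c) t ⟩
    2 * choose2 c + 2 * t              ≡⟨ cong (_+ 2 * t) (2*choose2 (length R′)) ⟩
    c * length R′ + 2 * t              ≤⟨ +-monoˡ-≤ (2 * t) (*-monoˡ-≤ (length R′) c≤2t) ⟩
    2 * t * length R′ + 2 * t          ≡⟨ factor t (length R′) ⟩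
    2 * (t * c)                        ∎)
    where
    factor : ∀ t d → 2 * t * d + 2 * t ≡ 2 * (t * suc d)
    factor = solve-∀

module _ {A : Set} (key colour : A → ℕ) where

  ascendingBichromatic : A → A → ℕ
  ascendingBichromatic x y = 𝟙 ((key x <ᵇ key y) ∧ not ⌊ colour x ≟ colour y ⌋)

  ∑∑ascendingBichromatic≤ : ∀ P → ∑ (λ x → ∑ (ascendingBichromatic x) P) P ≤ bichromaticPairs (map colour P)
  ∑∑ascendingBichromatic≤ []      = z≤n
  ∑∑ascendingBichromatic≤ (x ∷ P) = begin
    (F x x + ∑ (F x) P) + ∑ (λ y → F y x + ∑ (F y) P) P
      ≡⟨ cong₂ (λ a b → (a + ∑ (F x) P) + b)
               (cong (λ b → 𝟙 (b ∧ not ⌊ colour x ≟ colour x ⌋)) (<ᵇ-irrefl (key x)))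
               (∑-+ (λ y → F y x) (λ y → ∑ (F y) P) P) ⟩
    ∑ (F x) P + (∑ (λ y → F y x) P + ∑∑F P)
      ≡⟨ trans (sym (+-assoc (∑ (F x) P) _ _)) (cong (_+ ∑∑F P) (sym (∑-+ (F x) (λ y → F y x) P))) ⟩
    ∑ (λ y → F x y + F y x) P + ∑∑F P
      ≤⟨ +-mono-≤ (∑-mono P (λ y → ascending+descending≤ (key x) (key y) (cong not (⌊≟⌋-sym (colour y) (colour x)))))
                  (∑∑ascendingBichromatic≤ P) ⟩
    ∑ (λ y → 𝟙 (not ⌊ colour x ≟ colour y ⌋)) P + bichromaticPairs (map colour P)
      ≡⟨ cong (_+ bichromaticPairs (map colour P)) (sym (∑-map (λ s → 𝟙 (not ⌊ colour x ≟ s ⌋)) colour P)) ⟩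
    countNeq (colour x) (map colour P) + bichromaticPairs (map colour P)
      ≡⟨ +-comm _ (bichromaticPairs (map colour P)) ⟩
    bichromaticPairs (map colour (x ∷ P)) ∎
    where
    open ≤-Reasoning
    F : A → A → ℕ
    F = ascendingBichromatic
    ∑∑F : List A → ℕ
    ∑∑F Q = ∑ (λ y → ∑ (F y) Q) Q

-- Chains of adjacent list entries

module _ {V : Set} where

  lastOf : V → List V → V
  lastOf x []       = x
  lastOf x (y ∷ ys) = lastOf y ys

  lastOf-++ : ∀ x xs y ys → lastOf x (xs ++ y ∷ ys) ≡ lastOf y ys
  lastOf-++ x []        y ys = refl
  lastOf-++ x (x′ ∷ xs) y ys = lastOf-++ x′ xs y ys

  initOf : V → List V → List V
  initOf x []       = []
  initOf x (y ∷ ys) = x ∷ initOf y ys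

  initOf-lastOf : ∀ x xs → x ∷ xs ≡ initOf x xs ++ lastOf x xs ∷ []
  initOf-lastOf x []       = refl
  initOf-lastOf x (y ∷ ys) = cong (x ∷_) (initOf-lastOf y ys)

  reverse-∷ : ∀ x xs → Σ (List V) λ ys → reverse (x ∷ xs) ≡ lastOf x xs ∷ ys × lastOf (lastOf x xs) ys ≡ x
  reverse-∷ x xs = reverseAcc-∷ x xs []
    where
    reverseAcc-∷ : ∀ x xs acc → Σ (List V) λ ys →
                   reverseAcc (x ∷ acc) xs ≡ lastOf x xs ∷ ys × lastOf (lastOf x xs) ys ≡ lastOf x acc
    reverseAcc-∷ x []       acc = acc , refl , refl
    reverseAcc-∷ x (y ∷ ys) acc = reverseAcc-∷ y ys (x ∷ acc)

  ++-∷-head : ∀ {x xs} ys y zs zs′ → x ∷ xs ≡ ys ++ y ∷ zs → Σ (List V) λ ws → ys ++ y ∷ zs′ ≡ x ∷ ws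
  ++-∷-head []       y zs zs′ refl = zs′ , refl
  ++-∷-head (_ ∷ ys) y zs zs′ refl = ys ++ y ∷ zs′ , refl

  record Cut (x : V) (xs : List V) : Set where
    constructor cut
    field
      before     : List V
      left right : V
      after      : List V
      cut-≡      : x ∷ xs ≡ before ++ left ∷ right ∷ after
  open Cut public

  cuts : ∀ x xs → List (Cut x xs)
  cuts x []       = []
  cuts x (y ∷ ys) = cut [] x y ys refl ∷ map shift (cuts y ys)
    where
    shift : Cut y ys → Cut x (y ∷ ys)
    shift (cut b l r a e) = cut (x ∷ b) l r a (cong (x ∷_) e)

  map-right-cuts : ∀ x xs → map right (cuts x xs) ≡ xs
  map-right-cuts x []       = refl
  map-right-cuts x (y ∷ ys) = cong (y ∷_) (trans (sym (map-∘ (cuts y ys))) (map-right-cuts y ys))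

  map-left-cuts : ∀ x xs → map left (cuts x xs) ≡ initOf x xs
  map-left-cuts x []       = refl
  map-left-cuts x (y ∷ ys) = cong (x ∷_) (trans (sym (map-∘ (cuts y ys))) (map-left-cuts y ys))

  length-cuts : ∀ x xs → length (cuts x xs) ≡ length xs
  length-cuts x xs = trans (sym (length-map right (cuts x xs))) (cong length (map-right-cuts x xs))

  ∑-right-cuts : ∀ (f : V → ℕ) x xs → ∑ (f ∘ right) (cuts x xs) ≡ ∑ f xs
  ∑-right-cuts f x xs = trans (sym (∑-map f right (cuts x xs))) (cong (∑ f) (map-right-cuts x xs))

  ∑-left-cuts : ∀ (f : V → ℕ) x xs → ∑ (f ∘ left) (cuts x xs) ≡ ∑ f (initOf x xs)
  ∑-left-cuts f x xs = trans (sym (∑-map f left (cuts x xs))) (cong (∑ f) (map-left-cuts x xs))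

module _ {V : Set} (R : V → V → Bool) where

  Chain : List V → Set
  Chain []           = ⊤
  Chain (x ∷ [])     = ⊤
  Chain (x ∷ y ∷ ys) = R x y ≡ true × Chain (y ∷ ys)

  Link : List V → V → Set
  Link []       y = ⊤
  Link (x ∷ xs) y = R (lastOf x xs) y ≡ true

  chain-tail : ∀ x xs → Chain (x ∷ xs) → Chain xs
  chain-tail x []       _       = tt
  chain-tail x (y ∷ ys) (_ , c) = c

  chain-++⁺ : ∀ xs {y ys} → Chain xs → Link xs y → Chain (y ∷ ys) → Chain (xs ++ y ∷ ys)
  chain-++⁺ []            _        _    c = c
  chain-++⁺ (x ∷ [])      _        link c = link , c
  chain-++⁺ (x ∷ x′ ∷ xs) (r , cx) link c = r , chain-++⁺ (x′ ∷ xs) cx link c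

  chain-++⁻ : ∀ xs {y ys} → Chain (xs ++ y ∷ ys) → Chain xs × Link xs y × Chain (y ∷ ys)
  chain-++⁻ []            c       = tt , tt , c
  chain-++⁻ (x ∷ [])      (r , c) = tt , r , c
  chain-++⁻ (x ∷ x′ ∷ xs) (r , c) with chain-++⁻ (x′ ∷ xs) c
  ... | cx , link , cy = (r , cx) , link , cy

  chain-rotate : ∀ x cs F y G → x ∷ cs ≡ F ++ y ∷ G → Chain (x ∷ cs) → R (lastOf x cs) x ≡ true →
                 Chain (y ∷ G ++ F)
  chain-rotate x cs []      y G refl c _       rewrite ++-identityʳ G = c
  chain-rotate x cs (f ∷ F) y G refl c closing with chain-++⁻ (f ∷ F) {y} {G} c
  ... | cF , link , cG = chain-++⁺ (y ∷ G) cG (subst (λ z → R z f ≡ true) (lastOf-++ f F y G) closing) cF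

  module _ (R-sym : ∀ x y → R x y ≡ R y x) where

    chain-reverse : ∀ x xs → Chain (x ∷ xs) → Chain (reverse (x ∷ xs))
    chain-reverse x xs c = chain-reverseAcc x xs [] c tt
      where
      chain-reverseAcc : ∀ x xs acc → Chain (x ∷ xs) → Chain (x ∷ acc) → Chain (reverseAcc (x ∷ acc) xs)
      chain-reverseAcc x []       acc _       ca = ca
      chain-reverseAcc x (y ∷ ys) acc (r , c) ca = chain-reverseAcc y ys (x ∷ acc) c (trans (R-sym y x) r , ca)

    -- Pósa's crossing: if x ~ b and (last entry) ~ a for consecutive entries a, b, then
    -- reversing the segment from b to the end closes the chain into a cycle.
    chain-cross : ∀ x xs (c : Cut x xs) → Chain (x ∷ xs) → R x (right c) ≡ true → R (lastOf x xs) (left c) ≡ true →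
                  Σ (List V) λ cs → (x ∷ cs) ↭ (x ∷ xs) × Chain (x ∷ cs) × R (lastOf x cs) x ≡ true
    chain-cross x xs (cut pre a b suf x∷xs≡) c xb la with reverse-∷ b suf
    ... | tl , rev≡ , lastOf-rev = cs , cycle↭ , cycle-chain , closing
      where
      h : V
      h = lastOf b suf
      parts : Chain pre × Link pre a × Chain (a ∷ b ∷ suf)
      parts = chain-++⁻ pre (subst Chain x∷xs≡ c)
      reversed : Chain (h ∷ tl)
      reversed = subst Chain rev≡ (chain-reverse b suf (chain-tail a (b ∷ suf) (proj₂ (proj₂ parts))))
      ah : R a h ≡ true
      ah = trans (R-sym a h) (subst (λ z → R z a ≡ true) (trans (cong (lastOf x) x∷xs≡) (lastOf-++ x pre a (b ∷ suf))) la)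
      cs : List V
      cs = proj₁ (++-∷-head pre a (b ∷ suf) (h ∷ tl) x∷xs≡)
      cycle≡ : pre ++ a ∷ h ∷ tl ≡ x ∷ cs
      cycle≡ = proj₂ (++-∷-head pre a (b ∷ suf) (h ∷ tl) x∷xs≡)
      cycle↭ : (x ∷ cs) ↭ (x ∷ xs)
      cycle↭ = subst₂ _↭_ cycle≡ (sym x∷xs≡) (++⁺ˡ pre (prep a (subst (_↭ b ∷ suf) rev≡ (↭-reverse (b ∷ suf)))))
      cycle-chain : Chain (x ∷ cs)
      cycle-chain = subst Chain cycle≡ (chain-++⁺ pre (proj₁ parts) (proj₁ (proj₂ parts)) (ah , reversed))
      closing : R (lastOf x cs) x ≡ true
      closing = subst (λ z → R z x ≡ true) (trans (sym (lastOf-++ x pre a (h ∷ tl))) (cong (lastOf x) cycle≡))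
                      (subst (λ z → R z x ≡ true) (sym lastOf-rev) (trans (R-sym b x) xb))

chain-weaken : ∀ {V : Set} {R R′ : V → V → Bool} → (∀ x y → R x y ≡ true → R′ x y ≡ true) →
               ∀ xs → Chain R xs → Chain R′ xs
chain-weaken R⇒R′ []           _       = tt
chain-weaken R⇒R′ (x ∷ [])     _       = tt
chain-weaken R⇒R′ (x ∷ y ∷ ys) (r , c) = R⇒R′ x y r , chain-weaken R⇒R′ (y ∷ ys) c

-- Induced subgraphs

module _ {n : ℕ} where

  _∈?_ : (i : Fin n) (P : List (Fin n)) → Dec (i ∈ P)
  i ∈? P = any? (i Finₚ.≟_) P

  ∑ᵥ : (Fin n → ℕ) → ℕ
  ∑ᵥ f = ∑ f (allFin n)

  ∑-point : ∀ (f : Fin n → ℕ) v xs → Unique xs → v ∈ xs → ∑ (λ i → if ⌊ i Finₚ.≟ v ⌋ then f i else 0) xs ≡ f v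
  ∑-point f v (x ∷ xs) (x∉xs ∷ xs!) v∈ with x Finₚ.≟ v | v∈
  ... | yes refl | _         = trans (cong (f x +_) (∑-absent xs (λ x∈ → All.lookup x∉xs x∈ refl))) (+-identityʳ _)
    where
    ∑-absent : ∀ ys → v ∉ ys → ∑ (λ i → if ⌊ i Finₚ.≟ v ⌋ then f i else 0) ys ≡ 0
    ∑-absent []       _    = refl
    ∑-absent (y ∷ ys) v∉ys with y Finₚ.≟ v
    ... | yes refl = ⊥-elim (v∉ys (here refl))
    ... | no _     = ∑-absent ys (v∉ys ∘ there)
  ... | no x≢v   | here v≡x  = ⊥-elim (x≢v (sym v≡x))
  ... | no _     | there v∈′ = ∑-point f v xs xs! v∈′

  ∑ᵥ-point : ∀ (f : Fin n → ℕ) v → ∑ᵥ (λ i → if ⌊ i Finₚ.≟ v ⌋ then f i else 0) ≡ f v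
  ∑ᵥ-point f v = ∑-point f v (allFin n) (allFin⁺ n) (∈-allFin v)

  ∑ᵥ-restrict : ∀ (f : Fin n → ℕ) P → Unique P → ∑ᵥ (λ i → if ⌊ i ∈? P ⌋ then f i else 0) ≡ ∑ f P
  ∑ᵥ-restrict f []      _          = ∑-0 (allFin n)
  ∑ᵥ-restrict f (x ∷ P) (x∉P ∷ P!) = begin
    ∑ᵥ (λ i → if ⌊ i ∈? (x ∷ P) ⌋ then f i else 0)
      ≡⟨ ∑-cong (allFin n) split ⟩
    ∑ᵥ (λ i → (if ⌊ i Finₚ.≟ x ⌋ then f i else 0) + (if ⌊ i ∈? P ⌋ then f i else 0))
      ≡⟨ ∑-+ _ _ (allFin n) ⟩
    ∑ᵥ (λ i → if ⌊ i Finₚ.≟ x ⌋ then f i else 0) + ∑ᵥ (λ i → if ⌊ i ∈? P ⌋ then f i else 0)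
      ≡⟨ cong₂ _+_ (∑ᵥ-point f x) (∑ᵥ-restrict f P P!) ⟩
    f x + ∑ f P ∎
    where
    open ≡-Reasoning
    split : ∀ i → (if ⌊ i ∈? (x ∷ P) ⌋ then f i else 0) ≡
                  (if ⌊ i Finₚ.≟ x ⌋ then f i else 0) + (if ⌊ i ∈? P ⌋ then f i else 0)
    split i with i ∈? (x ∷ P) | i Finₚ.≟ x | i ∈? P
    ... | yes _          | yes refl | yes i∈P = ⊥-elim (All.lookup x∉P i∈P refl)
    ... | yes _          | yes refl | no _    = sym (+-identityʳ _)
    ... | yes _          | no _     | yes _   = refl
    ... | yes (here i≡x) | no i≢x   | no _    = ⊥-elim (i≢x i≡x)
    ... | yes (there i∈) | no _     | no i∉P  = ⊥-elim (i∉P i∈)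
    ... | no i∉          | yes refl | _       = ⊥-elim (i∉ (here refl))
    ... | no i∉          | no _     | yes i∈  = ⊥-elim (i∉ (there i∈))
    ... | no _           | no _     | no _    = refl

VertexSet : ℕ → Set
VertexSet n = Fin n → Bool

module Induced {n : ℕ} (H : Graph n) where

  adjIn : VertexSet n → Fin n → Fin n → Bool
  adjIn M i j = M i ∧ (M j ∧ adj H i j)

  adjIn-sym : ∀ M i j → adjIn M i j ≡ adjIn M j i
  adjIn-sym M i j with M i | M j
  ... | false | false = refl
  ... | false | true  = refl
  ... | true  | false = refl
  ... | true  | true  = adj-sym H i j

  adjIn-irrefl : ∀ M i → adjIn M i i ≡ false
  adjIn-irrefl M i with M i
  ... | false = refl
  ... | true  = adj-irrefl H i

  adjIn⇒∈ʳ : ∀ {M i j} → adjIn M i j ≡ true → M j ≡ true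
  adjIn⇒∈ʳ {M} {i} e = proj₁ (∧-true⁻ (proj₂ (∧-true⁻ {M i} e)))

  adjIn⇒adj : ∀ {M i j} → adjIn M i j ≡ true → adj H i j ≡ true
  adjIn⇒adj {M} {i} {j} e = proj₂ (∧-true⁻ {M j} (proj₂ (∧-true⁻ {M i} e)))

  ascending : Fin n → Fin n → Bool
  ascending i j = toℕ i <ᵇ toℕ j

  edgesIn : VertexSet n → ℕ
  edgesIn M = ∑ᵥ (λ i → ∑ᵥ (λ j → 𝟙 (ascending i j ∧ adjIn M i j)))

  card : VertexSet n → ℕ
  card M = ∑ᵥ (𝟙 ∘ M)

  degIn : VertexSet n → Fin n → ℕ
  degIn M i = ∑ᵥ (λ j → 𝟙 (adjIn M i j))

  degIn-within : ∀ M v P → Unique P → (∀ w → adjIn M v w ≡ true → w ∈ P) → degIn M v ≡ ∑ (λ w → 𝟙 (adjIn M v w)) P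
  degIn-within M v P P! N⊆P = trans (∑-cong (allFin n) within) (∑ᵥ-restrict (λ w → 𝟙 (adjIn M v w)) P P!)
    where
    within : ∀ w → 𝟙 (adjIn M v w) ≡ (if ⌊ w ∈? P ⌋ then 𝟙 (adjIn M v w) else 0)
    within w with adjIn M v w in vw | w ∈? P
    ... | false | yes _ = refl
    ... | false | no _  = refl
    ... | true  | yes _ = refl
    ... | true  | no w∉ = ⊥-elim (w∉ (N⊆P w vw))

  _∖_ : VertexSet n → VertexSet n → VertexSet n
  (M ∖ S) i = M i ∧ not (S i)

  edgesTouching : VertexSet n → VertexSet n → ℕ
  edgesTouching M S = ∑ᵥ (λ i → ∑ᵥ (λ j → 𝟙 ((ascending i j ∧ adjIn M i j) ∧ (S i ∨ S j))))

  edgesIn-∖ : ∀ M S → edgesIn M ≡ edgesIn (M ∖ S) + edgesTouching M S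
  edgesIn-∖ M S = trans (∑-cong (allFin n) (λ i →
                           trans (∑-cong (allFin n) (λ j → split (ascending i j) (M i) (S i) (M j) (S j) (adj H i j)))
                                 (∑-+ _ _ (allFin n))))
                         (∑-+ _ _ (allFin n))
    where
    split : ∀ l a e c f g → 𝟙 (l ∧ (a ∧ (c ∧ g))) ≡
            𝟙 (l ∧ ((a ∧ not e) ∧ ((c ∧ not f) ∧ g))) + 𝟙 ((l ∧ (a ∧ (c ∧ g))) ∧ (e ∨ f))
    split false _    _     _     _     _     = refl
    split true  false _     _     _     _     = refl
    split true  true  true  false _     _     = refl
    split true  true  true  true  _     false = refl
    split true  true  true  true  _     true  = refl
    split true  true  false false _     _     = refl
    split true  true  false true  true  false = refl
    split true  true  false true  true  true  = refl
    split true  true  false true  false false = refl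
    split true  true  false true  false true  = refl

  card-∖ : ∀ M S → (∀ i → S i ≡ true → M i ≡ true) → card M ≡ card (M ∖ S) + card S
  card-∖ M S S⊆M = trans (∑-cong (allFin n) (λ i → split (M i) (S i) (S⊆M i))) (∑-+ _ _ (allFin n))
    where
    split : ∀ a b → (b ≡ true → a ≡ true) → 𝟙 a ≡ 𝟙 (a ∧ not b) + 𝟙 b
    split true  true  _ = refl
    split true  false _ = refl
    split false false _ = refl
    split false true  b⇒a with b⇒a refl
    ... | ()

  edgesIn-≤-∖ : ∀ u M S → (∀ i → S i ≡ true → M i ≡ true) → edgesTouching M S ≤ u * card S →
                edgesIn (M ∖ S) ≤ u * card (M ∖ S) → edgesIn M ≤ u * card M
  edgesIn-≤-∖ u M S S⊆M touching rest = begin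
    edgesIn M                          ≡⟨ edgesIn-∖ M S ⟩
    edgesIn (M ∖ S) + edgesTouching M S ≤⟨ +-mono-≤ rest touching ⟩
    u * card (M ∖ S) + u * card S       ≡⟨ sym (*-distribˡ-+ u (card (M ∖ S)) (card S)) ⟩
    u * (card (M ∖ S) + card S)         ≡⟨ cong (u *_) (sym (card-∖ M S S⊆M)) ⟩
    u * card M                          ∎
    where open ≤-Reasoning

  edgesIn-empty : ∀ M → (∀ i → M i ≡ false) → edgesIn M ≡ 0
  edgesIn-empty M M≡∅ = trans (∑-cong (allFin n) (λ i → trans (∑-cong (allFin n) (no-edge i)) (∑-0 (allFin n)))) (∑-0 (allFin n))
    where
    no-edge : ∀ i j → 𝟙 (ascending i j ∧ adjIn M i j) ≡ 0
    no-edge i j rewrite M≡∅ i = cong 𝟙 (Boolₚ.∧-zeroʳ (ascending i j))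

  1≤card : ∀ M v → M v ≡ true → 1 ≤ card M
  1≤card M v Mv = subst (λ b → 𝟙 b ≤ card M) Mv (∑-member (𝟙 ∘ M) (allFin n) (∈-allFin v))

  card-∖-< : ∀ M S → (∀ i → S i ≡ true → M i ≡ true) → 1 ≤ card S → card (M ∖ S) < card M
  card-∖-< M S S⊆M 1≤S = begin-strict
    card (M ∖ S)           <⟨ m<m+n (card (M ∖ S)) 1≤S ⟩
    card (M ∖ S) + card S  ≡⟨ sym (card-∖ M S S⊆M) ⟩
    card M                 ∎
    where open ≤-Reasoning

  singleton : Fin n → VertexSet n
  singleton w i = ⌊ i Finₚ.≟ w ⌋

  card-singleton : ∀ w → card (singleton w) ≡ 1
  card-singleton w = ∑ᵥ-point (λ _ → 1) w

  edgesTouching-singleton≤ : ∀ M w → edgesTouching M (singleton w) ≤ degIn M w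
  edgesTouching-singleton≤ M w = begin
    edgesTouching M (singleton w)
      ≤⟨ ∑-mono (allFin n) (λ i → ∑-mono (allFin n) (λ j → 𝟙-∧-∨≤ (X i j) (singleton w i) (singleton w j))) ⟩
    ∑ᵥ (λ i → ∑ᵥ (λ j → (if singleton w i then 𝟙 (X i j) else 0) + (if singleton w j then 𝟙 (X i j) else 0)))
      ≡⟨ ∑-cong (allFin n) (λ i → trans (∑-+ _ _ (allFin n))
                                  (cong₂ _+_ (∑-if (singleton w i) (𝟙 ∘ X i) (allFin n)) (∑ᵥ-point (𝟙 ∘ X i) w))) ⟩
    ∑ᵥ (λ i → (if singleton w i then ∑ᵥ (𝟙 ∘ X i) else 0) + 𝟙 (X i w))
      ≡⟨ trans (∑-+ _ _ (allFin n)) (cong (_+ ∑ᵥ (λ i → 𝟙 (X i w))) (∑ᵥ-point (λ i → ∑ᵥ (𝟙 ∘ X i)) w)) ⟩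
    ∑ᵥ (𝟙 ∘ X w) + ∑ᵥ (λ i → 𝟙 (X i w))
      ≡⟨ sym (∑-+ _ _ (allFin n)) ⟩
    ∑ᵥ (λ j → 𝟙 (X w j) + 𝟙 (X j w))
      ≤⟨ ∑-mono (allFin n) (λ j → ascending+descending≤ (toℕ w) (toℕ j) (adjIn-sym M j w)) ⟩
    degIn M w ∎
    where
    open ≤-Reasoning
    X : Fin n → Fin n → Bool
    X i j = ascending i j ∧ adjIn M i j
    𝟙-∧-∨≤ : ∀ x p q → 𝟙 (x ∧ (p ∨ q)) ≤ (if p then 𝟙 x else 0) + (if q then 𝟙 x else 0)
    𝟙-∧-∨≤ false p     q     = z≤n
    𝟙-∧-∨≤ true  true  q     = s≤s z≤n
    𝟙-∧-∨≤ true  false true  = s≤s z≤n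
    𝟙-∧-∨≤ true  false false = z≤n

  setOf : List (Fin n) → VertexSet n
  setOf P i = ⌊ i ∈? P ⌋

  card-setOf : ∀ P → Unique P → card (setOf P) ≡ length P
  card-setOf P P! = trans (∑ᵥ-restrict (λ _ → 1) P P!) (∑-1 P)

module _ {n : ℕ} (H : Graph n) where

  chain⇒embedding : ∀ x xs → Unique (x ∷ xs) → Chain (adj H) (x ∷ xs) →
                    Σ (Fin (suc (length xs)) → Fin n) λ f → Injective _≡_ _≡_ f ×
                      (∀ i → adj H (f (inject₁ i)) (f (fsuc i)) ≡ true) × f fzero ≡ x × (∀ i → f i ∈ x ∷ xs)
  chain⇒embedding x []       _            _        = (λ _ → x) , (λ { {fzero} {fzero} _ → refl }) , (λ ()) , refl , (λ _ → here refl)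
  chain⇒embedding x (y ∷ ys) (x∉ ∷ y∷ys!) (xy , c) with chain⇒embedding y ys y∷ys! c
  ... | g , g-inj , g-adj , g0≡y , g∈ = f , f-inj , f-adj , refl , f∈
    where
    f : Fin (suc (suc (length ys))) → Fin n
    f fzero    = x
    f (fsuc i) = g i
    f-inj : Injective _≡_ _≡_ f
    f-inj {fzero}  {fzero}  _ = refl
    f-inj {fzero}  {fsuc j} e = ⊥-elim (All.lookup x∉ (subst (_∈ y ∷ ys) (sym e) (g∈ j)) refl)
    f-inj {fsuc i} {fzero}  e = ⊥-elim (All.lookup x∉ (subst (_∈ y ∷ ys) e (g∈ i)) refl)
    f-inj {fsuc i} {fsuc j} e = cong fsuc (g-inj e)
    f-adj : ∀ i → adj H (f (inject₁ i)) (f (fsuc i)) ≡ true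
    f-adj fzero    = subst (λ z → adj H x z ≡ true) (sym g0≡y) xy
    f-adj (fsuc i) = g-adj i
    f∈ : ∀ i → f i ∈ x ∷ y ∷ ys
    f∈ fzero    = here refl
    f∈ (fsuc i) = there (g∈ i)

  chain⇒ContainsPath : ∀ x xs → Unique (x ∷ xs) → Chain (adj H) (x ∷ xs) → ContainsPath (length xs) H
  chain⇒ContainsPath x xs x∷xs! c with f , f-inj , f-adj , _ ← chain⇒embedding x xs x∷xs! c = f , f-inj , f-adj

-- Properly t-coloured P_{2t}-free graphs

module PathFree {n : ℕ} (H : Graph n) (u : ℕ)
  (proper : ∀ i j → adj H i j ≡ true → toℕ i % suc u ≢ toℕ j % suc u)
  (free : ¬ ContainsPath (2 * suc u) H) where

  open Induced H

  t : ℕ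
  t = suc u

  colour : Fin n → ℕ
  colour i = toℕ i % t

  record ClosedPiece (M : VertexSet n) (P : List (Fin n)) : Set where
    field
      unique : Unique P
      inside : All (λ v → M v ≡ true) P
      short  : length P ≤ 2 * t
      closed : ∀ v w → v ∈ P → adjIn M v w ≡ true → w ∈ P

  -- Inside a closed piece every touching edge joins two vertices of the piece, of different colours.
  edgesTouching-closed≤ : ∀ M P → ClosedPiece M P → edgesTouching M (setOf P) ≤ u * card (setOf P)
  edgesTouching-closed≤ M P piece = begin
    edgesTouching M S
      ≤⟨ ∑-mono (allFin n) (λ i → ∑-mono (allFin n) (touching≤ i)) ⟩
    ∑ᵥ (λ i → ∑ᵥ (λ j → if S i then (if S j then F i j else 0) else 0))
      ≡⟨ ∑-cong (allFin n) (λ i → ∑-if (S i) (λ j → if S j then F i j else 0) (allFin n)) ⟩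
    ∑ᵥ (λ i → if S i then ∑ᵥ (λ j → if S j then F i j else 0) else 0)
      ≡⟨ ∑-cong (allFin n) (λ i → cong (λ z → if S i then z else 0) (∑ᵥ-restrict (F i) P unique)) ⟩
    ∑ᵥ (λ i → if S i then ∑ (F i) P else 0)
      ≡⟨ ∑ᵥ-restrict (λ i → ∑ (F i) P) P unique ⟩
    ∑ (λ i → ∑ (F i) P) P
      ≤⟨ ∑∑ascendingBichromatic≤ toℕ colour P ⟩
    bichromaticPairs (map colour P)
      ≤⟨ bichromaticPairs≤ u (map colour P) colours<t (≤-trans (≤-reflexive (length-map colour P)) short) ⟩
    u * length (map colour P)
      ≡⟨ cong (u *_) (trans (length-map colour P) (sym (card-setOf P unique))) ⟩
    u * card S ∎
    where
    open ≤-Reasoning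
    open ClosedPiece piece
    S : VertexSet n
    S = setOf P
    F : Fin n → Fin n → ℕ
    F = ascendingBichromatic toℕ colour
    colours<t : All (_< t) (map colour P)
    colours<t = Allₚ.map⁺ (All.universal (λ i → m%n<n (toℕ i) t) P)
    touching≤ : ∀ i j → 𝟙 ((ascending i j ∧ adjIn M i j) ∧ (S i ∨ S j)) ≤ (if S i then (if S j then F i j else 0) else 0)
    touching≤ i j with ascending i j | adjIn M i j in ij | i ∈? P | j ∈? P
    ... | false | _     | yes _ | yes _ = z≤n
    ... | false | _     | yes _ | no _  = z≤n
    ... | false | _     | no _  | _     = z≤n
    ... | true  | false | _     | _     = z≤n
    ... | true  | true  | yes _ | yes _ rewrite ⌊≟⌋-false (proper i j (adjIn⇒adj {M} ij)) = ≤-refl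
    ... | true  | true  | yes i∈ | no j∉ = ⊥-elim (j∉ (closed i j i∈ ij))
    ... | true  | true  | no i∉ | yes j∈ = ⊥-elim (i∉ (closed j i j∈ (trans (adjIn-sym M j i) ij)))
    ... | true  | true  | no _  | no _  = z≤n

  module Growth (M : VertexSet n) (highDegree : ∀ v → M v ≡ true → t ≤ degIn M v) where

    record IsPath (xs : List (Fin n)) : Set where
      constructor isPath
      field
        unique : Unique xs
        chain  : Chain (adjIn M) xs
        inside : All (λ v → M v ≡ true) xs
    open IsPath

    Longer : Fin n → List (Fin n) → Set
    Longer x xs = Σ (Fin n) λ y → Σ (List (Fin n)) λ ys → length ys ≡ suc (length xs) × IsPath (y ∷ ys)

    NeighboursIn : Fin n → List (Fin n) → Set
    NeighboursIn v P = ∀ w → adjIn M v w ≡ true → w ∈ P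

    outsideNeighbour? : ∀ v P → Dec (Σ (Fin n) λ w → adjIn M v w ≡ true × w ∉ P)
    outsideNeighbour? v P = Finₚ.any? (λ w → (adjIn M v w Boolₚ.≟ true) ×-dec ¬? (w ∈? P))

    noOutsideNeighbour : ∀ v P → ¬ (Σ (Fin n) λ w → adjIn M v w ≡ true × w ∉ P) → NeighboursIn v P
    noOutsideNeighbour v P none w vw with w ∈? P
    ... | yes w∈ = w∈
    ... | no w∉  = ⊥-elim (none (w , vw , w∉))

    prepend : ∀ {v w P} → adjIn M v w ≡ true → w ∉ v ∷ P → IsPath (v ∷ P) → IsPath (w ∷ v ∷ P)
    prepend {v} {w} {P} vw w∉ p =
      isPath (Allₚ.¬Any⇒All¬ (v ∷ P) w∉ ∷ unique p) (trans (adjIn-sym M w v) vw , chain p) (adjIn⇒∈ʳ {M} vw ∷ inside p)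

    append : ∀ {v w P} → adjIn M (lastOf v P) w ≡ true → w ∉ v ∷ P → IsPath (v ∷ P) → IsPath (v ∷ P ++ w ∷ [])
    append {v} {w} {P} lw w∉ p =
      isPath (Unique-resp-↭ (++-comm (w ∷ []) (v ∷ P)) (Allₚ.¬Any⇒All¬ (v ∷ P) w∉ ∷ unique p))
             (chain-++⁺ (adjIn M) (v ∷ P) (chain p) lw tt)
             (Allₚ.++⁺ (inside p) (adjIn⇒∈ʳ {M} lw ∷ []))

    extendOrSaturated : ∀ x xs → IsPath (x ∷ xs) →
                        Longer x xs ⊎ (NeighboursIn x (x ∷ xs) × NeighboursIn (lastOf x xs) (x ∷ xs))
    extendOrSaturated x xs p with outsideNeighbour? x (x ∷ xs)
    ... | yes (w , xw , w∉) = inj₁ (w , x ∷ xs , refl , prepend xw w∉ p)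
    ... | no noFront with outsideNeighbour? (lastOf x xs) (x ∷ xs)
    ... | yes (w , lw , w∉) = inj₁ (x , xs ++ w ∷ [] , trans (length-++ xs) (+-comm (length xs) 1) , append lw w∉ p)
    ... | no noBack         = inj₂ (noOutsideNeighbour x (x ∷ xs) noFront , noOutsideNeighbour (lastOf x xs) (x ∷ xs) noBack)

    -- Both ends have all their (at least t) neighbours on a path with fewer than 2t + 1
    -- vertices, so by pigeonhole some cut is crossed by both end neighbourhoods.
    saturated⇒cycle : ∀ x xs → length xs < 2 * t → IsPath (x ∷ xs) →
                      NeighboursIn x (x ∷ xs) → NeighboursIn (lastOf x xs) (x ∷ xs) →
                      Σ (List (Fin n)) λ cs → (x ∷ cs) ↭ (x ∷ xs) × Chain (adjIn M) (x ∷ cs) × adjIn M (lastOf x cs) x ≡ true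
    saturated⇒cycle x xs short p Nx Nl with satisfied (∑𝟙+∑𝟙>length⇒both (adjIn M x ∘ right) (adjIn M l ∘ left) (cuts x xs) crowded)
      where
      l : Fin n
      l = lastOf x xs
      t≤front : t ≤ ∑ (𝟙 ∘ adjIn M x) xs
      t≤front = ≤-trans (highDegree x (All.head (inside p))) (≤-reflexive (begin
        degIn M x                                   ≡⟨ degIn-within M x (x ∷ xs) (unique p) Nx ⟩
        𝟙 (adjIn M x x) + ∑ (𝟙 ∘ adjIn M x) xs      ≡⟨ cong (λ b → 𝟙 b + ∑ (𝟙 ∘ adjIn M x) xs) (adjIn-irrefl M x) ⟩
        ∑ (𝟙 ∘ adjIn M x) xs                        ∎))
        where open ≡-Reasoning
      t≤back : t ≤ ∑ (𝟙 ∘ adjIn M l) (initOf x xs)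
      t≤back = ≤-trans (highDegree l (All.lookup (inside p) l∈)) (≤-reflexive (begin
        degIn M l                                                  ≡⟨ degIn-within M l (x ∷ xs) (unique p) Nl ⟩
        ∑ (𝟙 ∘ adjIn M l) (x ∷ xs)                                 ≡⟨ cong (∑ (𝟙 ∘ adjIn M l)) (initOf-lastOf x xs) ⟩
        ∑ (𝟙 ∘ adjIn M l) (initOf x xs ++ l ∷ [])                  ≡⟨ ∑-++ (𝟙 ∘ adjIn M l) (initOf x xs) (l ∷ []) ⟩
        ∑ (𝟙 ∘ adjIn M l) (initOf x xs) + (𝟙 (adjIn M l l) + 0)
          ≡⟨ cong (λ b → ∑ (𝟙 ∘ adjIn M l) (initOf x xs) + (𝟙 b + 0)) (adjIn-irrefl M l) ⟩
        ∑ (𝟙 ∘ adjIn M l) (initOf x xs) + 0                        ≡⟨ +-identityʳ _ ⟩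
        ∑ (𝟙 ∘ adjIn M l) (initOf x xs)                            ∎))
        where
        open ≡-Reasoning
        l∈ : l ∈ x ∷ xs
        l∈ = subst (l ∈_) (sym (initOf-lastOf x xs)) (∈-++⁺ʳ (initOf x xs) (here refl))
      crowded : length (cuts x xs) < ∑ (𝟙 ∘ adjIn M x ∘ right) (cuts x xs) + ∑ (𝟙 ∘ adjIn M l ∘ left) (cuts x xs)
      crowded = begin-strict
        length (cuts x xs)                                     ≡⟨ length-cuts x xs ⟩
        length xs                                              <⟨ short ⟩
        t + (t + 0)                                            ≤⟨ +-mono-≤ t≤front (≤-trans (≤-reflexive (+-identityʳ t)) t≤back) ⟩
        ∑ (𝟙 ∘ adjIn M x) xs + ∑ (𝟙 ∘ adjIn M l) (initOf x xs)
          ≡⟨ sym (cong₂ _+_ (∑-right-cuts (𝟙 ∘ adjIn M x) x xs) (∑-left-cuts (𝟙 ∘ adjIn M l) x xs)) ⟩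
        ∑ (𝟙 ∘ adjIn M x ∘ right) (cuts x xs) + ∑ (𝟙 ∘ adjIn M l ∘ left) (cuts x xs) ∎
        where open ≤-Reasoning
    ... | c , xb , la = chain-cross (adjIn M) (adjIn-sym M) x xs c (chain p) xb la

    cycle⇒longerOrClosed : ∀ x xs cs → IsPath (x ∷ xs) → (x ∷ cs) ↭ (x ∷ xs) → Chain (adjIn M) (x ∷ cs) →
                           adjIn M (lastOf x cs) x ≡ true →
                           Longer x xs ⊎ (∀ v w → v ∈ x ∷ xs → adjIn M v w ≡ true → w ∈ x ∷ xs)
    cycle⇒longerOrClosed x xs cs p cycle↭ cycle closing
      with Finₚ.any? (λ v → (v ∈? (x ∷ xs)) ×-dec outsideNeighbour? v (x ∷ xs))
    ... | no none = inj₂ (λ v w v∈ vw → noOutsideNeighbour v (x ∷ xs) (none ∘ (v ,_) ∘ (v∈ ,_)) w vw)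
    ... | yes (v , v∈ , w , vw , w∉) with ∈-∃++ (Any-resp-↭ (↭-sym cycle↭) v∈)
    ... | F , G , split = inj₁ (w , v ∷ G ++ F , ↭-length rotated↭ , prepend vw (w∉ ∘ Any-resp-↭ rotated↭) rotated)
      where
      rotated↭ : (v ∷ G ++ F) ↭ (x ∷ xs)
      rotated↭ = ↭-trans (++-comm (v ∷ G) F) (subst (_↭ x ∷ xs) split cycle↭)
      rotated : IsPath (v ∷ G ++ F)
      rotated = isPath (Unique-resp-↭ (↭-sym rotated↭) (unique p))
                       (chain-rotate (adjIn M) x cs F v G split cycle closing)
                       (All-resp-↭ (↭-sym rotated↭) (inside p))

    longerOrClosed : ∀ x xs → length xs < 2 * t → IsPath (x ∷ xs) →
                     Longer x xs ⊎ (∀ v w → v ∈ x ∷ xs → adjIn M v w ≡ true → w ∈ x ∷ xs)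
    longerOrClosed x xs short p with extendOrSaturated x xs p
    ... | inj₁ longer   = inj₁ longer
    ... | inj₂ (Nx , Nl) with saturated⇒cycle x xs short p Nx Nl
    ... | cs , cycle↭ , cycle , closing = cycle⇒longerOrClosed x xs cs p cycle↭ cycle closing




    -- A path can be lengthened only until it has 2t + 1 vertices, which H forbids.
    grow : ∀ d x xs → suc (length xs) + d ≡ 2 * t → IsPath (x ∷ xs) →
           Σ (Fin n) λ y → Σ (List (Fin n)) λ ys → ClosedPiece M (y ∷ ys)
    grow d x xs len p with longerOrClosed x xs (≤-trans (m≤m+n (suc (length xs)) d) (≤-reflexive len)) p
    ... | inj₂ closed = x , xs , record
      { unique = unique p ; inside = inside p ; short = ≤-trans (m≤m+n _ d) (≤-reflexive len) ; closed = closed }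
    grow zero    x xs len p | inj₁ (y , ys , len′ , p′) =
      ⊥-elim (free (subst (λ m → ContainsPath m H) (trans len′ (trans (sym (+-identityʳ _)) len))
                          (chain⇒ContainsPath H y ys (unique p′) (chain-weaken (λ _ _ → adjIn⇒adj {M}) (y ∷ ys) (chain p′)))))
    grow (suc d) x xs len p | inj₁ (y , ys , len′ , p′) =
      grow d y ys (trans (cong (λ m → suc m + d) len′) (trans (sym (+-suc (suc (length xs)) d)) len)) p′

  record Removable (M : VertexSet n) : Set where
    field
      S        : VertexSet n
      S⊆M      : ∀ i → S i ≡ true → M i ≡ true
      nonempty : 1 ≤ card S
      sparse   : edgesTouching M S ≤ u * card S

  -- Either some vertex has degree at most u, or all degrees are at least t and growing a
  -- path from v yields a closed piece.
  removable : ∀ M v → M v ≡ true → Removable M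
  removable M v Mv with Finₚ.any? (λ i → (M i Boolₚ.≟ true) ×-dec (degIn M i <? t))
  ... | yes (w , Mw , deg<t) = record
    { S        = singleton w
    ; S⊆M      = λ i i≡w → subst (λ z → M z ≡ true) (sym (⌊⌋≡true⇒ (i Finₚ.≟ w) i≡w)) Mw
    ; nonempty = ≤-reflexive (sym (card-singleton w))
    ; sparse   = ≤-trans (edgesTouching-singleton≤ M w)
                         (≤-trans (≤-pred deg<t) (≤-reflexive (trans (sym (*-identityʳ u)) (cong (u *_) (sym (card-singleton w))))))
    }
  ... | no noLow = record
    { S        = setOf P
    ; S⊆M      = λ i i∈P → All.lookup inside (⌊⌋≡true⇒ (i ∈? P) i∈P)
    ; nonempty = ≤-trans (s≤s z≤n) (≤-reflexive (sym (card-setOf P unique)))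
    ; sparse   = edgesTouching-closed≤ M P piece
    }
    where
    highDegree : ∀ i → M i ≡ true → t ≤ degIn M i
    highDegree i Mi with degIn M i <? t
    ... | yes deg<t = ⊥-elim (noLow (i , Mi , deg<t))
    ... | no deg≮t  = ≮⇒≥ deg≮t
    grown : Σ (Fin n) λ y → Σ (List (Fin n)) λ ys → ClosedPiece M (y ∷ ys)
    grown = Growth.grow M highDegree (u + t) v [] (cong (λ m → suc (u + m)) (sym (+-identityʳ t)))
                        (Growth.isPath ([] ∷ []) tt (Mv ∷ []))
    P : List (Fin n)
    P = proj₁ grown ∷ proj₁ (proj₂ grown)
    piece : ClosedPiece M P
    piece = proj₂ (proj₂ grown)
    open ClosedPiece piece

  edgesIn≤ : ∀ s M → card M ≤ s → edgesIn M ≤ u * card M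
  edgesIn≤ s M card≤s with Finₚ.any? (λ i → M i Boolₚ.≟ true)
  ... | no empty = ≤-trans (≤-reflexive (edgesIn-empty M (λ i → Boolₚ.¬-not (empty ∘ (i ,_))))) z≤n
  edgesIn≤ zero    M card≤0 | yes (v , Mv) with ≤-trans (1≤card M v Mv) card≤0
  ... | ()
  edgesIn≤ (suc s) M card≤s | yes (v , Mv) =
    edgesIn-≤-∖ u M S S⊆M sparse (edgesIn≤ s (M ∖ S) (≤-pred (≤-trans (card-∖-< M S S⊆M nonempty) card≤s)))
    where open Removable (removable M v Mv)

  edges≤ : edges H ≤ u * n
  edges≤ = ≤-trans (edgesIn≤ (card all) all ≤-refl) (≤-reflexive (cong (u *_) (trans (∑-1 (allFin n)) (length-tabulate id))))
    where
    all : VertexSet n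
    all _ = true

-- Edges of the Turán graph

module TuranCount (u : ℕ) where

  t : ℕ
  t = suc u

  crossing : ℕ → ℕ → ℕ
  crossing a b = 𝟙 ((a <ᵇ b) ∧ not ⌊ a % t ≟ b % t ⌋)

  turanE : ℕ → ℕ
  turanE n = ∑< n (λ a → ∑< n (crossing a))

  edges-turan : ∀ n → edges (turan n t) ≡ turanE n
  edges-turan n = trans (cong sum (map-cong (λ i → ∑-allFin n (crossing (toℕ i))) (allFin n)))
                        (∑-allFin n (λ a → ∑< n (crossing a)))

  backDegree : ℕ → ℕ
  backDegree n = ∑< n (λ a → 𝟙 (not ⌊ a % t ≟ n % t ⌋))

  turanE-suc : ∀ n → turanE (suc n) ≡ turanE n + backDegree n
  turanE-suc n = begin
    ∑< n (λ a → ∑< n (crossing a) + crossing a n) + ∑< (suc n) (crossing n)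
      ≡⟨ cong₂ _+_ (∑<-+ n (λ a → ∑< n (crossing a)) (λ a → crossing a n)) no-forward ⟩
    turanE n + ∑< n (λ a → crossing a n) + 0
      ≡⟨ +-identityʳ _ ⟩
    turanE n + ∑< n (λ a → crossing a n)
      ≡⟨ cong (turanE n +_) (∑<-cong n (λ a a<n → cong (λ b → 𝟙 (b ∧ not ⌊ a % t ≟ n % t ⌋)) (<ᵇ-true a<n))) ⟩
    turanE n + backDegree n ∎
    where
    open ≡-Reasoning
    no-forward : ∑< (suc n) (crossing n) ≡ 0
    no-forward = trans (∑<-cong (suc n) (λ b b≤n → cong (λ x → 𝟙 (x ∧ not ⌊ n % t ≟ b % t ⌋)) (<ᵇ-false (≤-pred b≤n))))
                       (∑<-* (suc n) 0 (λ _ → 0))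

  [ρ+q*t]/t≡q : ∀ {ρ} q → ρ < t → (ρ + q * t) / t ≡ q
  [ρ+q*t]/t≡q {ρ} q ρ<t = trans (+-distrib-/-∣ʳ ρ (n∣m*n q)) (cong₂ _+_ (m<n⇒m/n≡0 ρ<t) (m*n/n≡m q t))

  [ρ+q*t]%t≡ρ : ∀ {ρ} q → ρ < t → (ρ + q * t) % t ≡ ρ
  [ρ+q*t]%t≡ρ {ρ} q ρ<t = trans ([m+kn]%n≡m%n ρ q t) (m<n⇒m%n≡m ρ<t)

  divMod-suc : ∀ n → (suc n / t ≡ n / t × suc n % t ≡ suc (n % t)) ⊎
                     (suc (n % t) ≡ t × suc n / t ≡ suc (n / t) × suc n % t ≡ 0)
  divMod-suc n with suc (n % t) <? t
  ... | yes ρ+1<t = inj₁ (trans (cong (_/ t) n+1≡) ([ρ+q*t]/t≡q (n / t) ρ+1<t) , trans (cong (_% t) n+1≡) ([ρ+q*t]%t≡ρ (n / t) ρ+1<t))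
    where
    n+1≡ : suc n ≡ suc (n % t) + n / t * t
    n+1≡ = cong suc (m≡m%n+[m/n]*n n t)
  ... | no ρ+1≮t = inj₂ (ρ+1≡t , trans (cong (_/ t) n+1≡) ([ρ+q*t]/t≡q (suc (n / t)) z<s)
                              , trans (cong (_% t) n+1≡) ([ρ+q*t]%t≡ρ (suc (n / t)) z<s))
    where
    ρ+1≡t : suc (n % t) ≡ t
    ρ+1≡t = ≤-antisym (m%n<n n t) (≮⇒≥ ρ+1≮t)
    n+1≡ : suc n ≡ 0 + suc (n / t) * t
    n+1≡ = trans (cong suc (m≡m%n+[m/n]*n n t)) (cong (_+ n / t * t) ρ+1≡t)

  residueCount : ℕ → ℕ → ℕ
  residueCount n r = ∑< n (λ a → 𝟙 ⌊ a % t ≟ r ⌋)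

  residueCount≡ : ∀ n r → r < t → residueCount n r ≡ n / t + 𝟙 (r <ᵇ n % t)
  residueCount≡ zero    r _   = refl
  residueCount≡ (suc n) r r<t = begin
    residueCount n r + 𝟙 ⌊ n % t ≟ r ⌋         ≡⟨ cong (_+ 𝟙 ⌊ n % t ≟ r ⌋) (residueCount≡ n r r<t) ⟩
    n / t + 𝟙 (r <ᵇ n % t) + 𝟙 ⌊ n % t ≟ r ⌋   ≡⟨ trans (+-assoc (n / t) _ _) (cong (n / t +_) (𝟙<ᵇ+𝟙≟ r (n % t))) ⟩
    n / t + 𝟙 (r <ᵇ suc (n % t))              ≡⟨ step (divMod-suc n) ⟩
    suc n / t + 𝟙 (r <ᵇ suc n % t)            ∎
    where
    open ≡-Reasoning
    step : _ → n / t + 𝟙 (r <ᵇ suc (n % t)) ≡ suc n / t + 𝟙 (r <ᵇ suc n % t)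
    step (inj₁ (q≡ , ρ≡))        = sym (cong₂ (λ q ρ → q + 𝟙 (r <ᵇ ρ)) q≡ ρ≡)
    step (inj₂ (ρ+1≡t , q≡ , ρ≡)) = begin
      n / t + 𝟙 (r <ᵇ suc (n % t))   ≡⟨ cong (λ b → n / t + 𝟙 b) (<ᵇ-true (subst (r <_) (sym ρ+1≡t) r<t)) ⟩
      n / t + 1                      ≡⟨ trans (+-comm (n / t) 1) (sym (+-identityʳ _)) ⟩
      suc (n / t) + 0                ≡⟨ sym (cong₂ (λ q ρ → q + 𝟙 (r <ᵇ ρ)) q≡ ρ≡) ⟩
      suc n / t + 𝟙 (r <ᵇ suc n % t) ∎

  backDegree+n/t : ∀ n → backDegree n + n / t ≡ n
  backDegree+n/t n = begin
    backDegree n + n / t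
      ≡⟨ cong (backDegree n +_) (sym (trans (residueCount≡ n (n % t) (m%n<n n t))
                                            (trans (cong (λ b → n / t + 𝟙 b) (<ᵇ-irrefl (n % t))) (+-identityʳ _)))) ⟩
    backDegree n + residueCount n (n % t)
      ≡⟨ sym (∑<-+ n _ _) ⟩
    ∑< n (λ a → 𝟙 (not ⌊ a % t ≟ n % t ⌋) + 𝟙 ⌊ a % t ≟ n % t ⌋)
      ≡⟨ ∑<-cong n (λ a _ → 𝟙-not+𝟙 ⌊ a % t ≟ n % t ⌋) ⟩
    ∑< n (λ _ → 1)
      ≡⟨ ∑<-1 n ⟩
    n ∎
    where open ≡-Reasoning

  triangle quotientSum : ℕ → ℕ
  triangle    n = ∑< n id
  quotientSum n = ∑< n (_/ t)

  2*triangle+n : ∀ n → 2 * triangle n + n ≡ n * n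
  2*triangle+n zero    = refl
  2*triangle+n (suc n) = trans (regroup (triangle n) n) (trans (cong (_+ suc (2 * n)) (2*triangle+n n)) (square n))
    where
    regroup : ∀ x n → 2 * (x + n) + suc n ≡ 2 * x + n + suc (2 * n)
    regroup = solve-∀
    square : ∀ n → n * n + suc (2 * n) ≡ suc n * suc n
    square = solve-∀

  turanE+quotientSum : ∀ n → turanE n + quotientSum n ≡ triangle n
  turanE+quotientSum zero    = refl
  turanE+quotientSum (suc n) rewrite turanE-suc n =
    trans (+-interchange (turanE n) (backDegree n) (quotientSum n) (n / t))
          (cong₂ _+_ (turanE+quotientSum n) (backDegree+n/t n))

  t*quotientSum≤triangle : ∀ n → t * quotientSum n ≤ triangle n
  t*quotientSum≤triangle n = ≤-trans (≤-reflexive (sym (∑<-* n t (_/ t))))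
    (∑<-mono n (λ a _ → ≤-trans (≤-reflexive (*-comm t (a / t))) (m/n*n≤m a t)))

  triangle≤t*quotientSum+u*n : ∀ n → triangle n ≤ t * quotientSum n + u * n
  triangle≤t*quotientSum+u*n n = begin
    ∑< n id                                       ≤⟨ ∑<-mono n (λ a _ → a≤ a) ⟩
    ∑< n (λ a → t * (a / t) + u)                  ≡⟨ ∑<-+ n (λ a → t * (a / t)) (λ _ → u) ⟩
    ∑< n (λ a → t * (a / t)) + ∑< n (λ _ → u)     ≡⟨ cong₂ _+_ (∑<-* n t (_/ t)) ∑<-const ⟩
    t * quotientSum n + u * n                     ∎
    where
    open ≤-Reasoning
    a≤ : ∀ a → a ≤ t * (a / t) + u
    a≤ a = begin
      a                   ≡⟨ m≡m%n+[m/n]*n a t ⟩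
      a % t + a / t * t   ≤⟨ +-monoˡ-≤ (a / t * t) (≤-pred (m%n<n a t)) ⟩
      u + a / t * t       ≡⟨ trans (+-comm u _) (cong (_+ u) (*-comm (a / t) t)) ⟩
      t * (a / t) + u     ∎
    ∑<-const : ∑< n (λ _ → u) ≡ u * n
    ∑<-const = trans (∑<-cong n (λ _ _ → sym (*-identityʳ u))) (trans (∑<-* n u (λ _ → 1)) (cong (u *_) (∑<-1 n)))

  -- t·E = t·T − t·Q, and T − u·n ≤ t·Q ≤ T for the triangle number T and quotient sum Q.
  t*turanE≡ : ∀ n → t * turanE n + t * quotientSum n ≡ triangle n + u * triangle n
  t*turanE≡ n = trans (sym (*-distribˡ-+ t (turanE n) (quotientSum n))) (cong (t *_) (turanE+quotientSum n))

  u*triangle≤t*turanE : ∀ n → u * triangle n ≤ t * turanE n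
  u*triangle≤t*turanE n = +-cancelˡ-≤ (triangle n) _ _ (begin
    triangle n + u * triangle n             ≡⟨ sym (t*turanE≡ n) ⟩
    t * turanE n + t * quotientSum n        ≤⟨ +-monoʳ-≤ (t * turanE n) (t*quotientSum≤triangle n) ⟩
    t * turanE n + triangle n               ≡⟨ +-comm (t * turanE n) _ ⟩
    triangle n + t * turanE n               ∎)
    where open ≤-Reasoning

  t*turanE≤u*triangle+u*n : ∀ n → t * turanE n ≤ u * triangle n + u * n
  t*turanE≤u*triangle+u*n n = +-cancelˡ-≤ (triangle n) _ _ (begin
    triangle n + t * turanE n                                ≡⟨ +-comm (triangle n) _ ⟩
    t * turanE n + triangle n                                ≤⟨ +-monoʳ-≤ (t * turanE n) (triangle≤t*quotientSum+u*n n) ⟩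
    t * turanE n + (t * quotientSum n + u * n)               ≡⟨ sym (+-assoc (t * turanE n) _ _) ⟩
    t * turanE n + t * quotientSum n + u * n                 ≡⟨ cong (_+ u * n) (t*turanE≡ n) ⟩
    triangle n + u * triangle n + u * n                      ≡⟨ +-assoc (triangle n) _ _ ⟩
    triangle n + (u * triangle n + u * n)                    ∎)
    where open ≤-Reasoning

  turanE-upper : ∀ m n → u * n ≤ m → 2 * t * u * turanE n ≤ m * m + (3 * u + u * u) * suc m
  turanE-upper m n un≤m = begin
    2 * t * u * turanE n                         ≡⟨ regroup u t (turanE n) ⟩
    2 * u * (t * turanE n)                       ≤⟨ *-monoʳ-≤ (2 * u) (t*turanE≤u*triangle+u*n n) ⟩
    2 * u * (u * triangle n + u * n)             ≡⟨ expand u (triangle n) n ⟩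
    u * u * (2 * triangle n) + 2 * u * (u * n)   ≤⟨ +-monoˡ-≤ _ (*-monoʳ-≤ (u * u) (m+n≤o⇒m≤o _ (≤-reflexive (2*triangle+n n)))) ⟩
    u * u * (n * n) + 2 * u * (u * n)            ≡⟨ cong (_+ 2 * u * (u * n)) (square u n) ⟩
    (u * n) * (u * n) + 2 * u * (u * n)          ≤⟨ +-mono-≤ (*-mono-≤ un≤m un≤m) (*-monoʳ-≤ (2 * u) un≤m) ⟩
    m * m + 2 * u * m
      ≤⟨ +-monoʳ-≤ (m * m) (*-mono-≤ (≤-trans (*-monoˡ-≤ u (n≤1+n 2)) (m≤m+n _ _)) (n≤1+n m)) ⟩
    m * m + (3 * u + u * u) * suc m              ∎
    where
    open ≤-Reasoning
    regroup : ∀ u t e → 2 * t * u * e ≡ 2 * u * (t * e)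
    regroup = solve-∀
    expand : ∀ u T n → 2 * u * (u * T + u * n) ≡ u * u * (2 * T) + 2 * u * (u * n)
    expand = solve-∀
    square : ∀ u n → u * u * (n * n) ≡ (u * n) * (u * n)
    square = solve-∀

  turanE-lower : ∀ m n → u * n ≤ m → m ≤ u * n + u → m * m ≤ 2 * t * u * turanE n + (3 * u + u * u) * suc m
  turanE-lower m n un≤m m≤un+u = begin
    m * m                                                   ≤⟨ *-mono-≤ m≤un+u m≤un+u ⟩
    (u * n + u) * (u * n + u)                               ≡⟨ expand u n ⟩
    u * u * (n * n) + 2 * u * (u * n) + u * u
      ≡⟨ cong (λ x → u * u * x + 2 * u * (u * n) + u * u) (sym (2*triangle+n n)) ⟩
    u * u * (2 * triangle n + n) + 2 * u * (u * n) + u * u  ≡⟨ regroup u n (triangle n) ⟩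
    2 * u * (u * triangle n) + 3 * u * (u * n) + u * u
      ≤⟨ +-monoˡ-≤ (u * u) (+-mono-≤ (*-monoʳ-≤ (2 * u) (u*triangle≤t*turanE n)) (*-monoʳ-≤ (3 * u) un≤m)) ⟩
    2 * u * (t * turanE n) + 3 * u * m + u * u              ≡⟨ regroup′ u t (turanE n) m ⟩
    2 * t * u * turanE n + (3 * u * m + u * u)
      ≤⟨ +-monoʳ-≤ (2 * t * u * turanE n) (≤-trans (m≤m+n _ (3 * u + u * u * m)) (≤-reflexive (sym (expand′ u m)))) ⟩
    2 * t * u * turanE n + (3 * u + u * u) * suc m          ∎
    where
    open ≤-Reasoning
    expand : ∀ u n → (u * n + u) * (u * n + u) ≡ u * u * (n * n) + 2 * u * (u * n) + u * u
    expand = solve-∀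
    regroup : ∀ u n T → u * u * (2 * T + n) + 2 * u * (u * n) + u * u ≡ 2 * u * (u * T) + 3 * u * (u * n) + u * u
    regroup = solve-∀
    regroup′ : ∀ u t e m → 2 * u * (t * e) + 3 * u * m + u * u ≡ 2 * t * u * e + (3 * u * m + u * u)
    regroup′ = solve-∀
    expand′ : ∀ u m → (3 * u + u * u) * suc m ≡ (3 * u * m + u * u) + (3 * u + u * u * m)
    expand′ = solve-∀

mainTheorem2 : (t : ℕ) → (h : 2 ≤ t) →
    Σ ℕ (λ K → (k : ℕ) → K ≤ k → InvExPathGe k (2 * t) (turanEdges k t h))
    × Σ ℕ (λ C → Σ ℕ (λ K → (k : ℕ) → K ≤ k →
        (2 * t * (t ∸ 1) * turanEdges k t h ≤ (k ∸ 1) * (k ∸ 1) + C * k)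
        × ((k ∸ 1) * (k ∸ 1) ≤ 2 * t * (t ∸ 1) * turanEdges k t h + C * k)))
mainTheorem2 (suc (suc w)) (s≤s (s≤s z≤n)) = (1 , inverseTuran) , (3 * u + u * u , 1 , asymptotics)
  where
  u : ℕ
  u = suc w
  open TuranCount u using (t; edges-turan; turanE-upper; turanE-lower)

  u*[m/u]≤m : ∀ m → u * (m / u) ≤ m
  u*[m/u]≤m m = ≤-trans (≤-reflexive (*-comm u (m / u))) (m/n*n≤m m u)

  m≤u*[m/u]+u : ∀ m → m ≤ u * (m / u) + u
  m≤u*[m/u]+u m = begin
    m                  ≡⟨ m≡m%n+[m/n]*n m u ⟩
    m % u + m / u * u  ≤⟨ +-monoˡ-≤ _ (m%n≤n m u) ⟩
    u + m / u * u      ≡⟨ trans (+-comm u _) (cong (_+ u) (*-comm (m / u) u)) ⟩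
    u * (m / u) + u    ∎
    where open ≤-Reasoning

  inverseTuran : ∀ k → 1 ≤ k → InvExPathGe k (2 * t) (turanEdges k t (s≤s (s≤s z≤n)))
  inverseTuran (suc m) _ = m / u , turan (m / u) t , sparse , ≤-refl
    where
    sparse : ExPathLt (turan (m / u) t) (2 * t) (suc m)
    sparse G G⊆T free = s≤s (≤-trans (PathFree.edges≤ G u (λ i j ij → not⌊⌋≡true⇒ _ (G⊆T i j ij)) free) (u*[m/u]≤m m))

  asymptotics : ∀ k → 1 ≤ k →
    (2 * t * u * turanEdges k t (s≤s (s≤s z≤n)) ≤ (k ∸ 1) * (k ∸ 1) + (3 * u + u * u) * k)
    × ((k ∸ 1) * (k ∸ 1) ≤ 2 * t * u * turanEdges k t (s≤s (s≤s z≤n)) + (3 * u + u * u) * k)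
  asymptotics (suc m) _ rewrite edges-turan (m / u) =
    turanE-upper m (m / u) (u*[m/u]≤m m) , turanE-lower m (m / u) (u*[m/u]≤m m) (m≤u*[m/u]+u m)
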